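{- Let $m=2^l m_1$ with $l\ge0$ and $m_1$ odd (and $m\ge2$). Then $L_m(3)=l$.
   Context: The Ducci function $D:\mathbb{Z}_m^3\to\mathbb{Z}_m^3$ is $D(x_1,x_2,x_3)=(x_1+x_2,\,x_2+x_3,\,x_3+x_1)$, entries mod $m$. For $\mathbf{u}\in\mathbb{Z}_m^3$, $\mathrm{Len}(\mathbf{u})$ is the smallest $j\ge0$ such that $D^{j+k}(\mathbf{u})=D^j(\mathbf{u})$ for some $k\ge1$, and $L_m(3)=\mathrm{Len}(0,0,1)$. -}

module Defs where

open import Data.Fin using (Fin; toℕ; combine)
open import Data.Fin.Properties using (pigeonhole; combine-injective)
  renaming (_≟_ to _≟ᶠ_)
open import Data.Nat using (ℕ; zero; suc; _+_; _*_; _∸_; _≤_; z≤n; s≤s; NonZero; >-nonZero)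
open import Data.Nat.DivMod using (_mod_)
open import Data.Nat.Properties hiding (_≟_)
open import Data.Product using (_×_; _,_; ∃; proj₁; proj₂)
open import Data.Product.Properties using (≡-dec)
open import Relation.Binary.Definitions using (DecidableEquality)
open import Relation.Binary.PropositionalEquality
open import Relation.Nullary using (Dec; yes; no; contradiction)
open import Relation.Nullary.Decidable using (map′)
import Function.Endo.Propositional as Endo

module _ {a} {A : Set a} where

  open Endo A using (_^_; ^-homo)

  EntersCycleAt : (A → A) → A → ℕ → Set a
  EntersCycleAt f u j = ∃ λ k → 1 ≤ k × (f ^ (j + k)) u ≡ (f ^ j) u

  IsLen : (A → A) → A → ℕ → Set a
  IsLen f u j = EntersCycleAt f u j × (∀ i → EntersCycleAt f u i → j ≤ i)

  private
    least : ∀ {p} (P : ℕ → Set p) → (∀ n → Dec (P n)) → ∀ n → P n →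
            ∃ λ j → P j × (∀ i → P i → j ≤ i)
    least P P? zero    pn = 0 , pn , λ _ _ → z≤n
    least P P? (suc n) pn with P? 0
    ... | yes p0 = 0 , p0 , λ _ _ → z≤n
    ... | no ¬p0 with least (λ k → P (suc k)) (λ k → P? (suc k)) n pn
    ...   | j , pj , min = suc j , pj , λ where
            zero    p0 → contradiction p0 ¬p0
            (suc i) pi → s≤s (min i pi)

  module _ (f : A → A) (u : A) where

    private
      ^-+ : ∀ m n → (f ^ (m + n)) u ≡ (f ^ m) ((f ^ n) u)
      ^-+ m n = cong (λ g → g u) (^-homo f m n)

      shift : ∀ d {s t} → (f ^ s) u ≡ (f ^ t) u → (f ^ (d + s)) u ≡ (f ^ (d + t)) u
      shift d {s} {t} eq = trans (^-+ d s) (trans (cong (f ^ d) eq) (sym (^-+ d t)))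

      multiple : ∀ s k → (f ^ (s + k)) u ≡ (f ^ s) u → ∀ c → (f ^ (c * k + s)) u ≡ (f ^ s) u
      multiple s k eq zero    = refl
      multiple s k eq (suc c) = begin
        (f ^ (k + c * k + s)) u   ≡⟨ cong (λ n → (f ^ n) u) (+-assoc k (c * k) s) ⟩
        (f ^ (k + (c * k + s))) u ≡⟨ shift k (multiple s k eq c) ⟩
        (f ^ (k + s)) u           ≡⟨ cong (λ n → (f ^ n) u) (+-comm k s) ⟩
        (f ^ (s + k)) u           ≡⟨ eq ⟩
        (f ^ s) u                 ∎
        where open ≡-Reasoning

      -- A period p seen from index i on is a period at every index where some
      -- period exists, which makes EntersCycleAt decidable.
      samePeriod : ∀ i p → (f ^ (p + i)) u ≡ (f ^ i) u →
                   ∀ s → EntersCycleAt f u s → (f ^ (s + p)) u ≡ (f ^ s) u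
      samePeriod i p eq s (k , 1≤k , eqₖ) = begin
        (f ^ (s + p)) u             ≡⟨ cong (λ n → (f ^ n) u) (+-comm s p) ⟩
        (f ^ (p + s)) u             ≡⟨ shift p (multiple s k eqₖ i) ⟨
        (f ^ (p + t)) u             ≡⟨ cong (λ n → (f ^ (p + n)) u) (m∸n+n≡m i≤t) ⟨
        (f ^ (p + (t ∸ i + i))) u   ≡⟨ cong (λ n → (f ^ n) u) swap ⟩
        (f ^ (t ∸ i + (p + i))) u   ≡⟨ shift (t ∸ i) eq ⟩
        (f ^ (t ∸ i + i)) u         ≡⟨ cong (λ n → (f ^ n) u) (m∸n+n≡m i≤t) ⟩
        (f ^ t) u                   ≡⟨ multiple s k eqₖ i ⟩
        (f ^ s) u                   ∎
        where
        open ≡-Reasoning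
        t : ℕ
        t = i * k + s
        i≤t : i ≤ t
        i≤t = ≤-trans (m≤m*n i k {{>-nonZero 1≤k}}) (m≤m+n (i * k) s)
        swap : p + (t ∸ i + i) ≡ t ∸ i + (p + i)
        swap = trans (sym (+-assoc p (t ∸ i) i))
                 (trans (cong (_+ i) (+-comm p (t ∸ i))) (+-assoc (t ∸ i) p i))

    lenExists : DecidableEquality A → ∀ {N} (index : A → Fin N) →
                (∀ {x y} → index x ≡ index y → x ≡ y) → ∃ (IsLen f u)
    lenExists _≟_ {N} index index-inj
      with pigeonhole (n<1+n N) (λ n → index ((f ^ toℕ n) u))
    ... | a , b , a<b , eq = least (EntersCycleAt f u) enters? i (p , 1≤p , periodAt-i)
      where
      i p : ℕ
      i = toℕ a
      p = toℕ b ∸ i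
      1≤p : 1 ≤ p
      1≤p = m<n⇒0<n∸m a<b
      period : (f ^ (p + i)) u ≡ (f ^ i) u
      period = trans (cong (λ n → (f ^ n) u) (m∸n+n≡m (<⇒≤ a<b))) (sym (index-inj eq))
      periodAt-i : (f ^ (i + p)) u ≡ (f ^ i) u
      periodAt-i = trans (cong (λ n → (f ^ n) u) (+-comm i p)) period
      enters? : ∀ s → Dec (EntersCycleAt f u s)
      enters? s = map′ (λ e → p , 1≤p , e) (samePeriod i p period s)
                       ((f ^ (s + p)) u ≟ (f ^ s) u)

-- Residues modulo m, as representatives 0, …, m - 1; addition is _⊕_ below.
ℤ/ : ℕ → Set
ℤ/ m = Fin m

ℤ/³ : ℕ → Set
ℤ/³ m = ℤ/ m × ℤ/ m × ℤ/ m

module _ (m : ℕ) .{{_ : NonZero m}} where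

  _⊕_ : ℤ/ m → ℤ/ m → ℤ/ m
  x ⊕ y = (toℕ x + toℕ y) mod m

  D : ℤ/³ m → ℤ/³ m
  D (x₁ , x₂ , x₃) = x₁ ⊕ x₂ , x₂ ⊕ x₃ , x₃ ⊕ x₁

  private
    _≟_ : DecidableEquality (ℤ/³ m)
    _≟_ = ≡-dec _≟ᶠ_ (≡-dec _≟ᶠ_ _≟ᶠ_)

    index : ℤ/³ m → Fin (m * (m * m))
    index (x , y , z) = combine x (combine y z)

    index-injective : ∀ {u v} → index u ≡ index v → u ≡ v
    index-injective {x , y , z} {x′ , y′ , z′} eq
      with refl , eq′ ← combine-injective x (combine y z) x′ (combine y′ z′) eq
      with refl , refl ← combine-injective y z y′ z′ eq′ = refl

  len : (u : ℤ/³ m) → ∃ (IsLen D u)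
  len u = lenExists D u _≟_ index index-injective

  Len : ℤ/³ m → ℕ
  Len u = proj₁ (len u)

  Len-isLen : ∀ u → IsLen D u (Len u)
  Len-isLen u = proj₂ (len u)

  -- L_m(3)
  L₃ : ℕ
  L₃ = Len (0 mod m , 0 mod m , 1 mod m)

{-# OPTIONS --safe #-}

-- Lift D to the map x ↦ (1 + S) x on ℕ³, S the cyclic shift.  It doubles the
-- coordinate sum, and its sixth power adds 21 times that sum to every
-- coordinate, because 1 + S acts as a sixth root of unity on vectors of sum
-- zero and 2⁶ - 1 = 3 · 21.
--
-- If D^(i+k) u = D^i u with k ≥ 1 then 2^(i+k) ≡ 2^i mod m, which is
-- impossible when 2^(i+1) ∣ m; hence l ≤ i.  Conversely D^(6q+l) u is D^l u
-- translated by 2^l (64^q - 1) / 3, and this vanishes mod m once the odd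
-- number m₁ divides (64^q - 1) / 3, which happens for some q ≥ 1.

module Submission where

open import Defs
open import Data.Fin using (toℕ)
open import Data.Fin.Properties using (pigeonhole; toℕ-fromℕ<; fromℕ<-cong)
open import Data.Nat using (ℕ; zero; suc; _+_; _*_; _^_; _∸_; _≤_; z≤n; s≤s; NonZero)
open import Data.Nat.Coprimality using (Coprime; coprime-divisor)
open import Data.Nat.Divisibility using (_∣_; _∣0; ∣-trans; ∣⇒≤; 0∣⇒≡0; ∣1⇒≡1; m∣m*n; n∣m*n; *-monoʳ-∣; ∣m+n∣m⇒∣n; %-presˡ-∣; ∣n∣m%n⇒∣m)
open import Data.Nat.DivMod using (_%_; _/_; _mod_; m≡m%n+[m/n]*n; m%n<n; %-distribˡ-+; %-remove-+ʳ)
open import Data.Nat.Properties using (+-assoc; +-comm; +-identityʳ; +-cancelˡ-≡; +-monoʳ-≤; *-comm; *-mono-≤; ^-distribˡ-+-*; ^-monoʳ-<; n<1+n; m<n⇒0<n∸m; m+[n∸m]≡n; <⇒≤; <⇒≱; ≮⇒≥; ≤-antisym; m^n≢0)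
open import Data.Nat.Tactic.RingSolver using (solve-∀)
open import Data.Product using (_×_; _,_; ∃; proj₁)
open import Relation.Binary.PropositionalEquality using (_≡_; refl; sym; trans; cong; cong₂; subst; module ≡-Reasoning)
open import Relation.Nullary using (¬_; contradiction)
import Function.Endo.Propositional as Endo

-- `L₃` comes out of a search, so its value is never computed. It is enough to show that `l` has the
-- defining property of a length.
IsLen-unique : ∀ {a} {A : Set a} {f : A → A} {u : A} {i j : ℕ} → IsLen f u i → IsLen f u j → i ≡ j
IsLen-unique (enterᵢ , minᵢ) (enterⱼ , minⱼ) = ≤-antisym (minᵢ _ enterⱼ) (minⱼ _ enterᵢ)

^-monoʳ-∣ : ∀ b {i j} → i ≤ j → b ^ i ∣ b ^ j
^-monoʳ-∣ b {i} {j} i≤j = subst (b ^ i ∣_) b^i*b^[j∸i]≡b^j (m∣m*n (b ^ (j ∸ i)))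
  where
  b^i*b^[j∸i]≡b^j : b ^ i * b ^ (j ∸ i) ≡ b ^ j
  b^i*b^[j∸i]≡b^j = trans (sym (^-distribˡ-+-* b i (j ∸ i))) (cong (b ^_) (m+[n∸m]≡n i≤j))

-- A common divisor of `m` and `n * n ^ a` is coprime to `n`, because it divides `m`. It therefore
-- divides `n ^ a`, and induction applies.
coprime-^ʳ : ∀ {m n} a → Coprime m n → Coprime m (n ^ a)
coprime-^ʳ zero    m⊥n (_ , d∣1)       = ∣1⇒≡1 d∣1
coprime-^ʳ (suc a) m⊥n (d∣m , d∣n*n^a) =
  coprime-^ʳ a m⊥n (d∣m , coprime-divisor (λ (e∣d , e∣n) → m⊥n (∣-trans e∣d d∣m , e∣n)) d∣n*n^a)

odd⇒coprime-2 : ∀ {m} → ¬ (2 ∣ m) → Coprime m 2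
odd⇒coprime-2 2∤m {0} (_ , 0∣2) = contradiction (0∣⇒≡0 0∣2) λ ()
odd⇒coprime-2 2∤m {1} _         = refl
odd⇒coprime-2 2∤m {2} (2∣m , _) = contradiction 2∣m 2∤m
odd⇒coprime-2 2∤m {suc (suc (suc _))} (_ , d∣2) = contradiction (∣⇒≤ d∣2) λ { (s≤s (s≤s ())) }

-- Cancelling the common remainder from the two division identities leaves `n` as a difference of
-- multiples of `d`, written additively to avoid subtraction.
[m+n]%d≡m%d⇒d∣n : ∀ m {n} d .{{_ : NonZero d}} → (m + n) % d ≡ m % d → d ∣ n
[m+n]%d≡m%d⇒d∣n m {n} d eq =
  ∣m+n∣m⇒∣n (subst (d ∣_) (sym quotients) (n∣m*n ((m + n) / d))) (n∣m*n (m / d))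
  where
  open ≡-Reasoning
  quotients : m / d * d + n ≡ (m + n) / d * d
  quotients = +-cancelˡ-≡ (m % d) _ _ (begin
    m % d + (m / d * d + n)           ≡⟨ +-assoc (m % d) (m / d * d) n ⟨
    m % d + m / d * d + n             ≡⟨ cong (_+ n) (m≡m%n+[m/n]*n m d) ⟨
    m + n                             ≡⟨ m≡m%n+[m/n]*n (m + n) d ⟩
    (m + n) % d + (m + n) / d * d     ≡⟨ cong (_+ (m + n) / d * d) eq ⟩
    m % d + (m + n) / d * d           ∎)

toℕ-mod : ∀ a m .{{_ : NonZero m}} → toℕ (a mod m) ≡ a % m
toℕ-mod a m = toℕ-fromℕ< (m%n<n a m)

%≡⇒mod≡ : ∀ a b m .{{_ : NonZero m}} → a % m ≡ b % m → a mod m ≡ b mod m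
%≡⇒mod≡ a b m eq = fromℕ<-cong _ _ eq _ _

mod≡⇒%≡ : ∀ a b m .{{_ : NonZero m}} → a mod m ≡ b mod m → a % m ≡ b % m
mod≡⇒%≡ a b m eq = trans (sym (toℕ-mod a m)) (trans (cong toℕ eq) (toℕ-mod b m))

mod-homo-+ : ∀ a b m .{{_ : NonZero m}} → _⊕_ m (a mod m) (b mod m) ≡ (a + b) mod m
mod-homo-+ a b m = %≡⇒mod≡ _ _ m
  (trans (cong (_% m) (cong₂ _+_ (toℕ-mod a m) (toℕ-mod b m))) (sym (%-distribˡ-+ a b m)))

-- repunit q = (64^q - 1) / 3
repunit : ℕ → ℕ
repunit zero    = 0
repunit (suc q) = 64 * repunit q + 21

-- In base 64, `repunit q` is the digit 21 repeated `q` times, and `a + d` digits split into the low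
-- `a` and the high `d`.
repunit-+ : ∀ a d → repunit (a + d) ≡ repunit a + 64 ^ a * repunit d
repunit-+ zero    d = sym (+-comm (repunit d) 0)
repunit-+ (suc a) d = trans (cong (λ r → 64 * r + 21) (repunit-+ a d))
                            (rearrange (repunit a) (64 ^ a) (repunit d))
  where
  rearrange : ∀ r p s → 64 * (r + p * s) + 21 ≡ 64 * r + 21 + 64 * p * s
  rearrange = solve-∀

-- Two of the first `n + 1` repunits agree mod `n`, and their difference is a power of 64 times a
-- repunit. Using repunits instead of `64 ^ q - 1` avoids dividing by 3, which need not be
-- invertible mod `n`.
odd∣repunit : ∀ {n} → ¬ (2 ∣ n) → ∃ λ q → 1 ≤ q × n ∣ repunit q
odd∣repunit {zero}  2∤n = contradiction (2 ∣0) 2∤n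
odd∣repunit {n@(suc _)} 2∤n
  with pigeonhole (n<1+n n) (λ i → repunit (toℕ i) mod n)
... | i , j , i<j , eq = d , m<n⇒0<n∸m i<j ,
    -- The exponent 6 is there because `2 ^ 6` computes to 64.
    coprime-divisor (coprime-^ʳ a (coprime-^ʳ 6 (odd⇒coprime-2 2∤n)))
      ([m+n]%d≡m%d⇒d∣n (repunit a) n repeats)
  where
  a d : ℕ
  a = toℕ i
  d = toℕ j ∸ a
  repeats : (repunit a + 64 ^ a * repunit d) % n ≡ repunit a % n
  repeats = trans
    (cong (_% n) (trans (sym (repunit-+ a d)) (cong repunit (m+[n∸m]≡n (<⇒≤ i<j)))))
    (sym (mod≡⇒%≡ (repunit a) (repunit (toℕ j)) n eq))

ℕ³ : Set
ℕ³ = ℕ × ℕ × ℕ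

≡³ : ∀ {a} {A : Set a} {x x′ y y′ z z′ : A} → x ≡ x′ → y ≡ y′ → z ≡ z′ → (x , y , z) ≡ (x′ , y′ , z′)
≡³ refl refl refl = refl

ducci : ℕ³ → ℕ³
ducci (x , y , z) = x + y , y + z , z + x

total : ℕ³ → ℕ
total (x , y , z) = x + y + z

translate : ℕ → ℕ³ → ℕ³
translate t (x , y , z) = x + t , y + t , z + t

e₃ : ℕ³
e₃ = 0 , 0 , 1

open Endo ℕ³ using () renaming (_^_ to _^ᴺ_)

total-ducci : ∀ v → total (ducci v) ≡ 2 * total v
total-ducci (x , y , z) = identity x y z
  where
  identity : ∀ x y z → (x + y) + (y + z) + (z + x) ≡ 2 * (x + y + z)
  identity = solve-∀

total-ducci^ : ∀ n → total ((ducci ^ᴺ n) e₃) ≡ 2 ^ n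
total-ducci^ zero    = refl
total-ducci^ (suc n) = trans (total-ducci ((ducci ^ᴺ n) e₃)) (cong (2 *_) (total-ducci^ n))

-- This is the binomial expansion of `(1 + S)^3` with `S^3 = 1`. Each new coordinate is three times
-- the sum minus the old one, so on sum zero the cube is negation.
ducci³ : ∀ x y z →
  (ducci ^ᴺ 3) (x , y , z) ≡ (2 * x + 3 * (y + z) , 2 * y + 3 * (z + x) , 2 * z + 3 * (x + y))
ducci³ x y z = ≡³ (binomial x y z) (binomial y z x) (binomial z x y)
  where
  binomial : ∀ x y z → x + y + (y + z) + (y + z + (z + x)) ≡ 2 * x + 3 * (y + z)
  binomial = solve-∀

-- With sum `s`, three steps send `x` to `3s - x` and `s` to `8s`, so six send `x` to
-- `24s - (3s - x) = x + 21s`.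
ducci⁶ : ∀ v → (ducci ^ᴺ 6) v ≡ translate (21 * total v) v
ducci⁶ (x , y , z) = begin
  (ducci ^ᴺ 3) ((ducci ^ᴺ 3) (x , y , z))    ≡⟨ cong (ducci ^ᴺ 3) (ducci³ x y z) ⟩
  (ducci ^ᴺ 3) (x′ , y′ , z′)                ≡⟨ ducci³ x′ y′ z′ ⟩
  (2 * x′ + 3 * (y′ + z′) , 2 * y′ + 3 * (z′ + x′) , 2 * z′ + 3 * (x′ + y′))
                                             ≡⟨ ≡³ (first x y z) (second x y z) (third x y z) ⟩
  translate (21 * (x + y + z)) (x , y , z)   ∎
  where
  open ≡-Reasoning
  x′ y′ z′ : ℕ
  x′ = 2 * x + 3 * (y + z)
  y′ = 2 * y + 3 * (z + x)
  z′ = 2 * z + 3 * (x + y)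
  first : ∀ x y z → 2 * (2 * x + 3 * (y + z)) + 3 * ((2 * y + 3 * (z + x)) + (2 * z + 3 * (x + y)))
                    ≡ x + 21 * (x + y + z)
  first = solve-∀
  second : ∀ x y z → 2 * (2 * y + 3 * (z + x)) + 3 * ((2 * z + 3 * (x + y)) + (2 * x + 3 * (y + z)))
                     ≡ y + 21 * (x + y + z)
  second = solve-∀
  third : ∀ x y z → 2 * (2 * z + 3 * (x + y)) + 3 * ((2 * x + 3 * (y + z)) + (2 * y + 3 * (z + x)))
                    ≡ z + 21 * (x + y + z)
  third = solve-∀

-- The translated vector has `1 + 3r` times the original sum, and `r + 21(1 + 3r) = 64r + 21`. This
-- is the recursion that defines `repunit`.
ducci⁶-translate : ∀ r v → (ducci ^ᴺ 6) (translate (r * total v) v) ≡ translate ((64 * r + 21) * total v) v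
ducci⁶-translate r v@(x , y , z) = trans (ducci⁶ (translate (r * total v) v))
  (≡³ (coordinate x r x y z) (coordinate y r x y z) (coordinate z r x y z))
  where
  coordinate : ∀ a r x y z →
    a + r * (x + y + z) + 21 * (x + r * (x + y + z) + (y + r * (x + y + z)) + (z + r * (x + y + z)))
    ≡ a + (64 * r + 21) * (x + y + z)
  coordinate = solve-∀

ducci^6q : ∀ q n v →
  let w = (ducci ^ᴺ n) v in (ducci ^ᴺ (q * 6 + n)) v ≡ translate (repunit q * total w) w
ducci^6q zero    n v = sym (≡³ (+-identityʳ _) (+-identityʳ _) (+-identityʳ _))
ducci^6q (suc q) n v =
  -- `suc q * 6 + n` unfolds to six further outer applications of `ducci`.
  trans (cong (ducci ^ᴺ 6) (ducci^6q q n v)) (ducci⁶-translate (repunit q) ((ducci ^ᴺ n) v))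

module _ (m : ℕ) .{{_ : NonZero m}} where

  open Endo (ℤ/³ m) using () renaming (_^_ to _^ᴰ_)

  reduce : ℕ³ → ℤ/³ m
  reduce (x , y , z) = x mod m , y mod m , z mod m

  D^-reduce : ∀ n v → (D m ^ᴰ n) (reduce v) ≡ reduce ((ducci ^ᴺ n) v)
  D^-reduce zero    v = refl
  -- Abstracting the iterate to an explicit triple lets `reduce` and `ducci` compute on it.
  D^-reduce (suc n) v with (ducci ^ᴺ n) v | D^-reduce n v
  ... | x , y , z | eq = trans (cong (D m) eq) (≡³ (mod-homo-+ x y m) (mod-homo-+ y z m) (mod-homo-+ z x m))

  reduce-translate : ∀ {t} → m ∣ t → ∀ v → reduce (translate t v) ≡ reduce v
  reduce-translate {t} m∣t (x , y , z) = ≡³ (absorb x) (absorb y) (absorb z)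
    where
    absorb : ∀ a → (a + t) mod m ≡ a mod m
    absorb a = %≡⇒mod≡ (a + t) a m (%-remove-+ʳ a m∣t)

  -- The right-hand side depends on `v` only through `reduce v`, so equal reductions give congruent
  -- sums.
  total-mod : ∀ v → total v mod m ≡ (let x , y , z = reduce v in _⊕_ m (_⊕_ m x y) z)
  total-mod (x , y , z) = sym (trans (cong (λ a → _⊕_ m a (z mod m)) (mod-homo-+ x y m)) (mod-homo-+ (x + y) z m))

  reduce≡⇒total%≡ : ∀ v w → reduce v ≡ reduce w → total v % m ≡ total w % m
  reduce≡⇒total%≡ v w eq = mod≡⇒%≡ (total v) (total w) m
    (trans (total-mod v) (trans (cong (λ (x , y , z) → _⊕_ m (_⊕_ m x y) z) eq) (sym (total-mod w))))

  enters⇒2^-recurs : ∀ i (enters : EntersCycleAt (D m) (reduce e₃) i) →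
                     2 ^ (i + proj₁ enters) % m ≡ 2 ^ i % m
  enters⇒2^-recurs i (k , _ , eq) = begin
    2 ^ (i + k) % m                         ≡⟨ cong (_% m) (total-ducci^ (i + k)) ⟨
    total ((ducci ^ᴺ (i + k)) e₃) % m       ≡⟨ reduce≡⇒total%≡ _ _ reduced ⟩
    total ((ducci ^ᴺ i) e₃) % m             ≡⟨ cong (_% m) (total-ducci^ i) ⟩
    2 ^ i % m                               ∎
    where
    open ≡-Reasoning
    reduced : reduce ((ducci ^ᴺ (i + k)) e₃) ≡ reduce ((ducci ^ᴺ i) e₃)
    reduced = trans (sym (D^-reduce (i + k) e₃)) (trans eq (D^-reduce i e₃))

  2^l∣m⇒l≤enters : ∀ l → 2 ^ l ∣ m → ∀ i → EntersCycleAt (D m) (reduce e₃) i → l ≤ i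
  2^l∣m⇒l≤enters l 2^l∣m i enters@(k , 1≤k , _) = ≮⇒≥ λ i<l →
    let 2^1+i∣m       = ∣-trans (^-monoʳ-∣ 2 i<l) 2^l∣m
        1+i≤i+k       = subst (_≤ i + k) (+-comm i 1) (+-monoʳ-≤ i 1≤k)
        -- Since `k` is positive, `2 ^ suc i` divides `2 ^ (i + k)`. Dividing `m` as well, it
        -- divides the residue, which is also that of `2 ^ i`.
        2^1+i∣2^i%m   = subst (2 ^ suc i ∣_) (enters⇒2^-recurs i enters)
                          (%-presˡ-∣ (^-monoʳ-∣ 2 1+i≤i+k) 2^1+i∣m)
        2^1+i∣2^i     = ∣n∣m%n⇒∣m 2^1+i∣m 2^1+i∣2^i%m
    in <⇒≱ (^-monoʳ-< 2 (s≤s (s≤s z≤n)) (n<1+n i)) (∣⇒≤ {{m^n≢0 2 i}} 2^1+i∣2^i)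

  enters-at-2-adic-valuation : ∀ l {m₁} → m ≡ 2 ^ l * m₁ → ¬ (2 ∣ m₁) →
                               EntersCycleAt (D m) (reduce e₃) l
  enters-at-2-adic-valuation l m≡2^l*m₁ 2∤m₁ with odd∣repunit 2∤m₁
  ... | q , 1≤q , m₁∣repunit = q * 6 , *-mono-≤ 1≤q (s≤s z≤n) , (begin
    (D m ^ᴰ (l + q * 6)) (reduce e₃)              ≡⟨ cong (λ n → (D m ^ᴰ n) (reduce e₃)) (+-comm l (q * 6)) ⟩
    (D m ^ᴰ (q * 6 + l)) (reduce e₃)              ≡⟨ D^-reduce (q * 6 + l) e₃ ⟩
    reduce ((ducci ^ᴺ (q * 6 + l)) e₃)            ≡⟨ cong reduce (ducci^6q q l e₃) ⟩
    reduce (translate (repunit q * total w) w)    ≡⟨ reduce-translate m∣shift w ⟩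
    reduce w                                      ≡⟨ D^-reduce l e₃ ⟨
    (D m ^ᴰ l) (reduce e₃)                        ∎)
    where
    open ≡-Reasoning
    w : ℕ³
    w = (ducci ^ᴺ l) e₃
    shift≡ : 2 ^ l * repunit q ≡ repunit q * total w
    shift≡ = trans (*-comm (2 ^ l) (repunit q)) (cong (repunit q *_) (sym (total-ducci^ l)))
    -- The sum `total w` is `2 ^ l`, which supplies the even part of `m`, and the repunit supplies
    -- `m₁`.
    m∣shift : m ∣ repunit q * total w
    m∣shift = subst (m ∣_) shift≡ (subst (_∣ 2 ^ l * repunit q) (sym m≡2^l*m₁) (*-monoʳ-∣ (2 ^ l) m₁∣repunit))

theorem4p1 : ∀ (m l m₁ : ℕ) .{{_ : NonZero m}} → 2 ≤ m → m ≡ 2 ^ l * m₁ → ¬ (2 ∣ m₁) → L₃ m ≡ l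
theorem4p1 m l m₁ 2≤m m≡2^l*m₁ 2∤m₁ = IsLen-unique (Len-isLen m (reduce m e₃))
  ( enters-at-2-adic-valuation m l m≡2^l*m₁ 2∤m₁
  , 2^l∣m⇒l≤enters m l (subst (2 ^ l ∣_) (sym m≡2^l*m₁) (m∣m*n m₁)) )
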